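{- Let $G$ be a connected, reduced bipartite graph with partite sets $A=\{a_1,\dots,a_m\}$ and $B$, where $m=|A|\le |B|$ and $m=2k$ with $k\ge 3$. Suppose the poset $P_A$ has height $h(P_A)\ge 3$. Then $\mathcal{R}(G)\le k$.
   Context: $N(x)$ denotes the neighborhood of a vertex $x$. A graph is reduced if no two vertices have the same neighborhood. $P_A$ is the poset on $A$ given by $a\preceq b$ iff $N(a)\subseteq N(b)$ (the poset induced by the neighborhood inclusion graph of $G$ with respect to $A$). A chain is a set of pairwise comparable elements; the height $h(P_A)$ is the maximum size of a chain. Letters $x,y$ alternate in a word $w$ if the subsequence of $w$ consisting of occurrences of $x$ and $y$ is $xyxy\cdots$ or $yxyx\cdots$. A word $w$ over the vertex set of a graph (containing every vertex) represents the graph if two vertices are adjacent iff they alternate in $w$. A word is $k$-uniform if each letter occurs exactly $k$ times. $\mathcal{R}(G)$ is the least $k$ such that some $k$-uniform word represents $G$. -}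

module Defs where

open import Data.Nat using (ℕ; zero; suc; _≤_; _*_)
open import Data.Fin using (Fin)
open import Data.Fin.Properties using (_≟_)
open import Data.Bool using (Bool; true; false)
open import Data.Bool.Properties renaming (_≟_ to _≟ᵇ_)
open import Data.List using (List; []; _∷_; length; filter; allFin)
open import Data.List.Membership.Propositional using (_∈_)
open import Data.List.Relation.Unary.All using (All)
open import Data.List.Relation.Unary.Unique.Propositional using (Unique)
open import Data.List.Relation.Unary.Linked using (Linked)
open import Data.List.Relation.Unary.AllPairs using (AllPairs)
open import Data.Product using (Σ; ∃; ∃-syntax; _×_; _,_)
open import Data.Sum using (_⊎_)
open import Relation.Binary.PropositionalEquality using (_≡_; _≢_)
open import Relation.Nullary.Decidable using (_⊎-dec_)
open import Function.Bundles using (_⇔_)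

record Graph (n : ℕ) : Set where
  field
    adj    : Fin n → Fin n → Bool
    sym    : ∀ x y → adj x y ≡ adj y x
    irrefl : ∀ x → adj x x ≡ false
open Graph public

Adj : ∀ {n} → Graph n → Fin n → Fin n → Set
Adj G x y = adj G x y ≡ true

data Walk {n} (G : Graph n) : Fin n → Fin n → Set where
  here : ∀ {x} → Walk G x x
  step : ∀ {x y z} → Adj G x y → Walk G y z → Walk G x z

Connected : ∀ {n} → Graph n → Set
Connected G = ∀ x y → Walk G x y

NbhdSub : ∀ {n} → Graph n → Fin n → Fin n → Set
NbhdSub G x y = ∀ z → Adj G x z → Adj G y z

Reduced : ∀ {n} → Graph n → Set
Reduced G = ∀ x y → NbhdSub G x y → NbhdSub G y x → x ≡ y

-- Bipartite graphs with a designated bipartition.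
-- side v ≡ true  means v ∈ A,  side v ≡ false means v ∈ B.

IsBipartition : ∀ {n} → Graph n → (Fin n → Bool) → Set
IsBipartition G side = ∀ x y → Adj G x y → side x ≢ side y

InA : ∀ {n} → (Fin n → Bool) → Fin n → Set
InA side v = side v ≡ true

sizeA : ∀ {n} → (Fin n → Bool) → ℕ
sizeA {n} side = length (filter (λ v → side v ≟ᵇ true) (allFin n))

sizeB : ∀ {n} → (Fin n → Bool) → ℕ
sizeB {n} side = length (filter (λ v → side v ≟ᵇ false) (allFin n))

-- The poset P_A (a ⪯ b iff N(a) ⊆ N(b)), chains and height ≥ h.

Comparable : ∀ {n} → Graph n → Fin n → Fin n → Set
Comparable G a b = NbhdSub G a b ⊎ NbhdSub G b a

IsChainA : ∀ {n} → Graph n → (Fin n → Bool) → List (Fin n) → Set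
IsChainA G side c = Unique c × All (InA side) c × AllPairs (Comparable G) c

HeightAtLeast : ∀ {n} → Graph n → (Fin n → Bool) → ℕ → Set
HeightAtLeast G side h = ∃[ c ] (IsChainA G side c × h ≤ length c)

restrict : ∀ {n} → Fin n → Fin n → List (Fin n) → List (Fin n)
restrict x y w = filter (λ c → (c ≟ x) ⊎-dec (c ≟ y)) w

-- x and y alternate in w: the restriction is xyxy… or yxyx…,
-- i.e. (for x ≢ y) no two consecutive letters of it are equal.
Alternate : ∀ {n} → Fin n → Fin n → List (Fin n) → Set
Alternate x y w = Linked _≢_ (restrict x y w)

Represents : ∀ {n} → List (Fin n) → Graph n → Set
Represents w G =
  (∀ v → v ∈ w) ×
  (∀ x y → x ≢ y → (Adj G x y ⇔ Alternate x y w))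

occ : ∀ {n} → Fin n → List (Fin n) → ℕ
occ v w = length (filter (_≟ v) w)

Uniform : ∀ {n} → ℕ → List (Fin n) → Set
Uniform k w = ∀ v → occ v w ≡ k

-- 𝓡(G) ≤ k : the least k' admitting a k'-uniform representing word is ≤ k,
-- i.e. some k' ≤ k admits one.
RLeq : ∀ {n} → Graph n → ℕ → Set
RLeq G k = ∃[ k' ] (k' ≤ k × ∃[ w ] (Uniform k' w × Represents w G))

{-# OPTIONS --safe #-}
module Submission where

-- Take a word p₁ p₂ … p_k of permutations of A and insert each z ∈ B once near the end of every pᵢ. Inserted exactly
-- between pᵢ and pᵢ₊₁, z alternates with all of A; shifting it over a suffix of pᵢ or a prefix of pᵢ₊₁ breaks the
-- alternation with exactly the letters passed. If pᵢ ends with u v and pᵢ₊₁ starts with u, all four subsets of {u, v}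
-- can be broken there, so k − 2 cuts take care of 2k − 4 letters of A. The other four letters are a chain
-- N(a) ⊆ N(b) ⊆ N(c) and a letter x. The non-neighbours of z in {a, b, c} form an initial segment of a, b, c, so
-- the cut c b a | a b c can break them on either side; x is broken at the end of the word. Choosing the side
-- according to whether z is adjacent to x makes the last two passes through B opposite to each other, so no
-- two vertices of B alternate; the last two permutations of A are also opposite, up to one pair.

open import Defs renaming (sym to adj-sym)
open import Data.Bool using (Bool; true; false; not; _∧_; if_then_else_; f≤t; b≤b) renaming (_≤_ to _≤ᵇ_)
open import Data.Bool.Properties using (¬-not) renaming (_≟_ to _≟ᵇ_)
open import Data.Empty using (⊥-elim)
open import Data.Fin using (Fin)
open import Data.Fin.Properties using (_≟_)
open import Data.List using (List; []; _∷_; [_]; _++_; reverse; filter; map; length; allFin)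
open import Data.List.Properties using (++-identityʳ; filter-++; filter-none; filter-some; filter-accept; filter-reject; filter-≐; unfold-reverse; reverse-++; reverse-involutive; ++-assoc; length-++)
open import Data.List.Membership.Propositional using (_∈_)
open import Data.List.Membership.Propositional.Properties using (∈-filter⁺; ∈-filter⁻; ∈-allFin; ∈-++⁺ʳ; ∈-∃++)
open import Data.List.Relation.Binary.Permutation.Propositional using (_↭_; ↭-trans; prep; ↭⇒↭ₛ)
open import Data.List.Relation.Binary.Permutation.Propositional.Properties using (shift; ++-comm; ↭-length; ∈-resp-↭)
import Data.List.Relation.Binary.Permutation.Setoid.Properties as PermSetoid
open import Data.List.Relation.Unary.All as All using (All; []; _∷_)
open import Data.List.Relation.Unary.AllPairs using ([]; _∷_)
open import Data.List.Relation.Unary.Any as Any using (here; there; any?)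
open import Data.List.Relation.Unary.Any.Properties using (reverse⁺; reverse⁻)
open import Data.List.Relation.Unary.Linked using (Linked; []; [-]; _∷_)
open import Data.List.Relation.Unary.Unique.Propositional using (Unique)
open import Data.List.Relation.Unary.Unique.Propositional.Properties using (allFin⁺; filter⁺)
open import Data.Nat using (ℕ; suc; _+_; _≤_; _*_; s≤s)
open import Data.Nat.Properties using (<⇒≢; ≤-refl; +-assoc; *-suc; *-distribˡ-+; +-cancelˡ-≡; suc-injective)
open import Data.Product using (∃-syntax; _×_; _,_; proj₁; proj₂)
open import Data.Sum using (_⊎_; inj₁; inj₂)
open import Function using (_∘_)
open import Function.Bundles using (_⇔_; mk⇔; Equivalence)
open import Level using (0ℓ)
open import Relation.Binary.PropositionalEquality using (_≡_; _≢_; refl; sym; trans; cong; cong₂; subst; ≢-sym; setoid)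
open import Relation.Nullary using (¬_; Dec; does; yes; no)
open import Relation.Nullary.Decidable using (dec-true; dec-false; decidable-stable; _⊎-dec_)
open import Relation.Unary using (Pred; Decidable)

-- Lists

-- A positive witness that alternation fails. Unlike the negation of `Linked _≢_`, it is carried
-- along directly by concatenation and `map`, so one doubled letter in a factor settles the whole
-- word.
data Repeats {A : Set} : List A → Set where
  now   : ∀ {x xs} → Repeats (x ∷ x ∷ xs)
  later : ∀ {x xs} → Repeats xs → Repeats (x ∷ xs)

Repeats⇒¬Linked : ∀ {A : Set} {xs : List A} → Repeats xs → ¬ Linked _≢_ xs
Repeats⇒¬Linked now       (x≢x ∷ _) = x≢x refl
Repeats⇒¬Linked (later r) (_ ∷ l)   = Repeats⇒¬Linked r l
Repeats⇒¬Linked (later ()) [-]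

Repeats-++ˡ : ∀ {A : Set} {xs : List A} ys → Repeats xs → Repeats (xs ++ ys)
Repeats-++ˡ ys now       = now
Repeats-++ˡ ys (later r) = later (Repeats-++ˡ ys r)

Repeats-++ʳ : ∀ {A : Set} xs {ys : List A} → Repeats ys → Repeats (xs ++ ys)
Repeats-++ʳ []       r = r
Repeats-++ʳ (x ∷ xs) r = later (Repeats-++ʳ xs r)

Repeats-map : ∀ {A B : Set} (f : A → B) {xs} → Repeats xs → Repeats (map f xs)
Repeats-map f now       = now
Repeats-map f (later r) = later (Repeats-map f r)

-- The last letter of `xs` is also the first of `reverse xs`, so it stands doubled at the junction.
-- Membership of `y` only serves to make `xs` nonempty.
Repeats-mirror : ∀ {A : Set} {y : A} {xs} → y ∈ xs → Repeats (xs ++ reverse xs)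
Repeats-mirror {y = y} {xs} y∈xs with reverse xs in eq
... | []     with () ← subst (y ∈_) eq (reverse⁺ y∈xs)
... | z ∷ zs = subst (λ l → Repeats (l ++ z ∷ zs)) (sym split)
                 (subst Repeats (sym (++-assoc (reverse zs) [ z ] (z ∷ zs))) (Repeats-++ʳ (reverse zs) now))
  where
  split : xs ≡ reverse zs ++ [ z ]
  split = trans (sym (reverse-involutive xs)) (trans (cong reverse eq) (unfold-reverse z zs))

module _ {A : Set} {P : Pred A 0ℓ} (P? : Decidable P) where

  filter-reverse : ∀ xs → filter P? (reverse xs) ≡ reverse (filter P? xs)
  filter-reverse []       = refl
  filter-reverse (x ∷ xs) = trans (cong (filter P?) (unfold-reverse x xs))
    (trans (filter-++ P? (reverse xs) [ x ])
    (trans (cong (_++ filter P? [ x ]) (filter-reverse xs)) last-step))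
    where
    last-step : reverse (filter P? xs) ++ filter P? [ x ] ≡ reverse (filter P? (x ∷ xs))
    last-step = trans
      (cong (reverse (filter P? xs) ++_) (reverse-≤1 x))
      (trans (sym (reverse-++ (filter P? [ x ]) (filter P? xs)))
             (cong reverse (sym (filter-++ P? [ x ] xs))))
      where
      reverse-≤1 : ∀ x → filter P? [ x ] ≡ reverse (filter P? [ x ])
      reverse-≤1 x with does (P? x)
      ... | true  = refl
      ... | false = refl

  filter-single : ∀ {xs y} → Unique xs → y ∈ xs → P y → (∀ {z} → z ∈ xs → P z → z ≡ y) →
                  filter P? xs ≡ [ y ]
  filter-single {y = y} (y∉xs ∷ _) (here refl) py only =
    trans (filter-accept P? py) (cong (y ∷_)
      (filter-none P? (All.tabulate λ z∈xs pz → All.lookup y∉xs z∈xs (sym (only (there z∈xs) pz)))))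
  filter-single (x∉xs ∷ u) (there y∈xs) py only =
    trans (filter-reject P? λ px → All.lookup x∉xs y∈xs (only (here refl) px))
          (filter-single u y∈xs py λ z∈xs → only (there z∈xs))

restrict-comm : ∀ {n} (y z : Fin n) w → restrict y z w ≡ restrict z y w
restrict-comm y z = filter-≐ _ _ (swap , swap)
  where
  swap : ∀ {A B : Set} → A ⊎ B → B ⊎ A
  swap (inj₁ p) = inj₂ p
  swap (inj₂ p) = inj₁ p

infix 7 _==_

_==_ : ∀ {n} → Fin n → Fin n → Bool
y == z = does (y ≟ z)

≢⇒==false : ∀ {n} {y z : Fin n} → y ≢ z → y == z ≡ false
≢⇒==false {y = y} {z} = dec-false (y ≟ z)

≡⇒==true : ∀ {n} {y z : Fin n} → y ≡ z → y == z ≡ true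
≡⇒==true {y = y} {z} = dec-true (y ≟ z)

-- Words made of one-sided blocks

-- A block stands for all selected vertices of one side, listed in the order of `allFin` or in
-- reverse. The restriction to a vertex of `A` and one of `B` then depends only on Boolean values of
-- `selects`, and alternation between the sides becomes a computation. The direction matters only
-- for two vertices of the same side.
record Block (n : ℕ) : Set where
  constructor block
  field
    inA      : Bool
    backward : Bool
    selects  : Fin n → Bool

open Block

pattern A→ f = block true false f
pattern A← f = block true true f
pattern B→ f = block false false f
pattern B← f = block false true f

flipBlock : ∀ {n} → Block n → Block n
flipBlock (block s d f) = block s (not d) f

mirror : ∀ {n} → List (Block n) → List (Block n)
mirror []       = []
mirror (β ∷ βs) = mirror βs ++ [ flipBlock β ]

-- Two vertices of one side do not see the blocks of the other. Once these are dropped, the mirror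
-- symmetry of the concrete block lists holds by `refl`.
keep : ∀ {n} → Bool → List (Block n) → List (Block n)
keep true  (block true  d f ∷ βs) = block true d f ∷ keep true βs
keep true  (block false d f ∷ βs) = keep true βs
keep false (block true  d f ∷ βs) = keep false βs
keep false (block false d f ∷ βs) = block false d f ∷ keep false βs
keep _ [] = []

letter : Bool → Bool → List Bool
letter s true  = [ s ]
letter s false = []

-- For y ∈ A and b ∈ B, the restriction of a block word to y and b, with true written for y and false for b.
trace : ∀ {n} → Fin n → Fin n → List (Block n) → List Bool
trace y b [] = []
trace y b (block true  d f ∷ βs) = letter true (f y) ++ trace y b βs
trace y b (block false d f ∷ βs) = letter false (f b) ++ trace y b βs

trace-++ : ∀ {n} (y b : Fin n) βs γs → trace y b (βs ++ γs) ≡ trace y b βs ++ trace y b γs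
trace-++ y b [] γs = refl
trace-++ y b (block true  d f ∷ βs) γs =
  trans (cong (letter true (f y) ++_) (trace-++ y b βs γs)) (sym (++-assoc (letter true (f y)) _ _))
trace-++ y b (block false d f ∷ βs) γs =
  trans (cong (letter false (f b) ++_) (trace-++ y b βs γs)) (sym (++-assoc (letter false (f b)) _ _))

indicator : Bool → ℕ
indicator true  = 1
indicator false = 0

count : ∀ {n} → Bool → Fin n → List (Block n) → ℕ
count s y [] = 0
count true  y (block true  d f ∷ βs) = indicator (f y) + count true y βs
count true  y (block false d f ∷ βs) = count true y βs
count false y (block true  d f ∷ βs) = count false y βs
count false y (block false d f ∷ βs) = indicator (f y) + count false y βs

count-++ : ∀ {n} s (y : Fin n) βs γs → count s y (βs ++ γs) ≡ count s y βs + count s y γs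
count-++ true  y [] γs = refl
count-++ false y [] γs = refl
count-++ true  y (block true  d f ∷ βs) γs =
  trans (cong (indicator (f y) +_) (count-++ true y βs γs)) (sym (+-assoc (indicator (f y)) _ _))
count-++ true  y (block false d f ∷ βs) γs = count-++ true y βs γs
count-++ false y (block true  d f ∷ βs) γs = count-++ false y βs γs
count-++ false y (block false d f ∷ βs) γs =
  trans (cong (indicator (f y) +_) (count-++ false y βs γs)) (sym (+-assoc (indicator (f y)) _ _))

pick : ∀ {A : Set} → A → A → Bool → A
pick y b true  = y
pick y b false = b

module Words {n : ℕ} (side : Fin n → Bool) where

  contains : Block n → Fin n → Bool
  contains β z = does (inA β ≟ᵇ side z) ∧ selects β z

  forward : Block n → List (Fin n)
  forward β = filter (λ z → contains β z ≟ᵇ true) (allFin n)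

  letters : Block n → List (Fin n)
  letters β = if backward β then reverse (forward β) else forward β

  word : List (Block n) → List (Fin n)
  word []       = []
  word (β ∷ βs) = letters β ++ word βs

  word-++ : ∀ βs γs → word (βs ++ γs) ≡ word βs ++ word γs
  word-++ []       γs = refl
  word-++ (β ∷ βs) γs = trans (cong (letters β ++_) (word-++ βs γs)) (sym (++-assoc (letters β) _ _))

  letters-flip : ∀ β → letters (flipBlock β) ≡ reverse (letters β)
  letters-flip (block s true  f) = sym (reverse-involutive (forward (block s true f)))
  letters-flip (block s false f) = refl

  word-mirror : ∀ βs → word (mirror βs) ≡ reverse (word βs)
  word-mirror []       = refl
  word-mirror (β ∷ βs) = trans (word-++ (mirror βs) [ flipBlock β ])
    (trans (cong₂ _++_ (word-mirror βs) (trans (++-identityʳ (letters (flipBlock β))) (letters-flip β)))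
           (sym (reverse-++ (letters β) (word βs))))

  ∈-letters⁻ : ∀ β {z} → z ∈ letters β → contains β z ≡ true
  ∈-letters⁻ (block s true  f) z∈ = proj₂ (∈-filter⁻ (λ z → contains (block s true f) z ≟ᵇ true) {xs = allFin n} (reverse⁻ z∈))
  ∈-letters⁻ (block s false f) z∈ = proj₂ (∈-filter⁻ (λ z → contains (block s false f) z ≟ᵇ true) {xs = allFin n} z∈)

  module _ {P : Pred (Fin n) 0ℓ} (P? : Decidable P) where

    filter-letters-none : ∀ β → (∀ {z} → contains β z ≡ true → ¬ P z) → filter P? (letters β) ≡ []
    filter-letters-none β none = filter-none P? (All.tabulate λ z∈ → none (∈-letters⁻ β z∈))

    filter-letters-single : ∀ β {y} → contains β y ≡ true → P y →
      (∀ {z} → contains β z ≡ true → P z → z ≡ y) → filter P? (letters β) ≡ [ y ]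
    filter-letters-single β {y} cy py only = go (backward β) refl
      where
      fwd : filter P? (forward β) ≡ [ y ]
      fwd = filter-single P? (filter⁺ _ (allFin⁺ n)) (∈-filter⁺ _ (∈-allFin y) cy) py
              (λ z∈ → only (proj₂ (∈-filter⁻ (λ z → contains β z ≟ᵇ true) {xs = allFin n} z∈)))
      go : ∀ d → backward β ≡ d → filter P? (letters β) ≡ [ y ]
      -- A one-letter list is its own reverse, so the direction of the block has no effect.
      go true  eq rewrite eq = trans (filter-reverse P? (forward β)) (cong reverse fwd)
      go false eq rewrite eq = fwd

  contains-own : ∀ β {z} → side z ≡ inA β → contains β z ≡ selects β z
  contains-own (block true  d f) e rewrite e = refl
  contains-own (block false d f) e rewrite e = refl

  contains-other : ∀ β {z} → side z ≡ not (inA β) → contains β z ≡ false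
  contains-other (block true  d f) e rewrite e = refl
  contains-other (block false d f) e rewrite e = refl

  contains-≢ : ∀ {β y z} → contains β y ≡ true → contains β z ≡ false → y ≢ z
  contains-≢ e e′ refl with () ← trans (sym e) e′

  occ-letters : ∀ β y → occ y (letters β) ≡ indicator (contains β y)
  occ-letters β y with contains β y in e
  ... | true  = cong length (filter-letters-single (_≟ y) β e refl (λ _ z≡y → z≡y))
  ... | false = cong length (filter-letters-none (_≟ y) β λ { cz refl → contains-≢ {β} cz e refl })

  occ-++ : ∀ (y : Fin n) xs ys → occ y (xs ++ ys) ≡ occ y xs + occ y ys
  occ-++ y xs ys = trans (cong length (filter-++ (_≟ y) xs ys)) (length-++ (filter (_≟ y) xs))

  occ-word : ∀ {s y} → side y ≡ s → ∀ βs → occ y (word βs) ≡ count s y βs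
  occ-word {true}  e [] = refl
  occ-word {false} e [] = refl
  occ-word {s} {y} e (β ∷ βs) = trans (occ-++ y (letters β) (word βs))
    (trans (cong₂ _+_ (occ-letters β y) (occ-word e βs)) (unfold s β e))
    where
    unfold : ∀ s β → side y ≡ s → indicator (contains β y) + count s y βs ≡ count s y (β ∷ βs)
    unfold true  (block true  d f) e rewrite e = refl
    unfold true  (block false d f) e rewrite e = refl
    unfold false (block true  d f) e rewrite e = refl
    unfold false (block false d f) e rewrite e = refl

  restrict-++ : ∀ (y z : Fin n) xs ys → restrict y z (xs ++ ys) ≡ restrict y z xs ++ restrict y z ys
  restrict-++ y z = filter-++ (λ c → (c ≟ y) ⊎-dec (c ≟ z))

  restrict-letters-none : ∀ {y z} β → contains β y ≡ false → contains β z ≡ false → restrict y z (letters β) ≡ []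
  restrict-letters-none β ey ez = filter-letters-none _ β
    λ { c (inj₁ refl) → contains-≢ {β} c ey refl ; c (inj₂ refl) → contains-≢ {β} c ez refl }

  restrict-letters-single : ∀ {y z} β → contains β y ≡ true → contains β z ≡ false → restrict y z (letters β) ≡ [ y ]
  restrict-letters-single β ey ez = filter-letters-single _ β ey (inj₁ refl)
    λ { c (inj₁ z≡y) → z≡y ; c (inj₂ refl) → ⊥-elim (contains-≢ {β} c ez refl) }

  -- A block is one-sided, so it contains at most one of `y` and `b` and contributes at most one
  -- letter, whatever its direction.
  restrict-word : ∀ {y b} → side y ≡ true → side b ≡ false → ∀ βs →
                  restrict y b (word βs) ≡ map (pick y b) (trace y b βs)
  restrict-word sy sb [] = refl
  restrict-word {y} {b} sy sb (β ∷ βs) = trans (restrict-++ y b (letters β) (word βs))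
    (trans (cong (restrict y b (letters β) ++_) (restrict-word sy sb βs)) (unfold β))
    where
    unfold : ∀ β → restrict y b (letters β) ++ map (pick y b) (trace y b βs) ≡ map (pick y b) (trace y b (β ∷ βs))
    unfold β@(block true d f) with f y in e
    ... | true  = cong (_++ _) (restrict-letters-single β (trans (contains-own β sy) e) (contains-other β sb))
    ... | false = cong (_++ _) (restrict-letters-none β (trans (contains-own β sy) e) (contains-other β sb))
    unfold β@(block false d f) with f b in e
    ... | true  = cong (_++ _) (trans (restrict-comm y b (letters β))
                    (restrict-letters-single β (trans (contains-own β sb) e) (contains-other β sy)))
    ... | false = cong (_++ _) (restrict-letters-none β (contains-other β sy) (trans (contains-own β sb) e))

  restrict-keep : ∀ {s y z} → side y ≡ s → side z ≡ s → ∀ βs →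
                  restrict y z (word βs) ≡ restrict y z (word (keep s βs))
  restrict-keep {true}  sy sz [] = refl
  restrict-keep {false} sy sz [] = refl
  restrict-keep {true} {y} {z} sy sz (β@(block true d f) ∷ βs) =
    trans (restrict-++ y z (letters β) _) (trans (cong (_ ++_) (restrict-keep sy sz βs)) (sym (restrict-++ y z (letters β) _)))
  restrict-keep {true} {y} {z} sy sz (β@(block false d f) ∷ βs) =
    trans (restrict-++ y z (letters β) _)
      (cong₂ _++_ (restrict-letters-none β (contains-other β sy) (contains-other β sz)) (restrict-keep sy sz βs))
  restrict-keep {false} {y} {z} sy sz (β@(block true d f) ∷ βs) =
    trans (restrict-++ y z (letters β) _)
      (cong₂ _++_ (restrict-letters-none β (contains-other β sy) (contains-other β sz)) (restrict-keep sy sz βs))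
  restrict-keep {false} {y} {z} sy sz (β@(block false d f) ∷ βs) =
    trans (restrict-++ y z (letters β) _) (trans (cong (_ ++_) (restrict-keep sy sz βs)) (sym (restrict-++ y z (letters β) _)))

  restrict-word-none : ∀ {s y z} → side y ≡ s → side z ≡ s → ∀ βs → count s y βs ≡ 0 → count s z βs ≡ 0 →
                       restrict y z (word βs) ≡ []
  restrict-word-none {y = y} {z} sy sz βs cy cz = filter-none (λ v → (v ≟ y) ⊎-dec (v ≟ z)) (All.tabulate none)
    where
    absent : ∀ {s v} → side v ≡ s → count s v βs ≡ 0 → ¬ v ∈ word βs
    absent {v = v} sv cv v∈ = <⇒≢ (filter-some (_≟ v) (Any.map sym v∈)) (sym (trans (occ-word sv βs) cv))
    none : ∀ {v} → v ∈ word βs → ¬ (v ≡ y ⊎ v ≡ z)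
    none v∈ (inj₁ refl) = absent sy cy v∈
    none v∈ (inj₂ refl) = absent sz cz v∈

  ∈-word : ∀ {s y} → side y ≡ s → ∀ βs → count s y βs ≢ 0 → y ∈ word βs
  ∈-word {y = y} sy βs c≢0 with any? (y ≟_) (word βs)
  ... | yes y∈ = y∈
  ... | no  y∉ = ⊥-elim (c≢0 (trans (sym (occ-word sy βs))
                   (cong length (filter-none (_≟ y) (All.tabulate λ { v∈ refl → y∉ v∈ })))))

  -- Reading M forwards and then backwards doubles the letter of {y, z} nearest to the turning point.
  palindrome : ∀ {s y z} → side y ≡ s → side z ≡ s → ∀ βs pre M N post →
    keep s βs ≡ pre ++ M ++ N ++ mirror M ++ post →
    count s y M ≢ 0 → count s y N ≡ 0 → count s z N ≡ 0 → Repeats (restrict y z (word βs))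
  palindrome {s} {y} {z} sy sz βs pre M N post eq cM yN zN =
    subst Repeats (sym shape) (Repeats-++ʳ (r pre) (subst Repeats (++-assoc (r M) _ _)
      (Repeats-++ˡ (r post) (Repeats-mirror (∈-filter⁺ _ (∈-word sy M cM) (inj₁ refl))))))
    where
    r : List (Block n) → List (Fin n)
    r γs = restrict y z (word γs)
    r-++ : ∀ γs δs → r (γs ++ δs) ≡ r γs ++ r δs
    r-++ γs δs = trans (cong (restrict y z) (word-++ γs δs)) (restrict-++ y z (word γs) (word δs))
    r-mirror : r (mirror M) ≡ reverse (r M)
    r-mirror = trans (cong (restrict y z) (word-mirror M)) (filter-reverse _ (word M))
    shape : r βs ≡ r pre ++ r M ++ reverse (r M) ++ r post
    shape = trans (restrict-keep sy sz βs) (trans (cong r eq)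
      (trans (r-++ pre _) (cong (r pre ++_) (trans (r-++ M _) (cong (r M ++_)
      (trans (r-++ N _) (cong₂ _++_ (restrict-word-none sy sz N yN zN)
      (trans (r-++ (mirror M) _) (cong (_++ r post) r-mirror)))))))))

-- Gadgets

-- The last two letters of one permutation of A are u v, and the next permutation starts with u (p is the letter
-- the current one starts with, already written). Cutting before u v, between them, after them, or after the
-- second u breaks exactly {u, v}, {v}, ∅, {u}.
-- p, u, v mark the vertices of A named by these letters; nu and nv mark the neighbours of u and v.
gadgetBlocks : ∀ {n} (p u v nu nv : Fin n → Bool) → List (Block n)
gadgetBlocks p u v nu nv =
  A→ (λ z → not (p z) ∧ not (u z) ∧ not (v z)) ∷
  B→ (λ z → not (nu z) ∧ not (nv z)) ∷ A→ u ∷ B→ (λ z → nu z ∧ not (nv z)) ∷ A→ v ∷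
  B→ (λ z → nu z ∧ nv z) ∷ A← u ∷ B→ (λ z → not (nu z) ∧ nv z) ∷ []

-- The first pass through B in endingBlocks.
turnB : ∀ {n} (nx na nb nc : Fin n → Bool) → List (Block n)
turnB nx na nb nc =
  B→ (λ z → nx z ∧ not (nc z)) ∷ B→ (λ z → nx z ∧ nc z ∧ not (nb z)) ∷
  B→ (λ z → nx z ∧ nb z ∧ not (na z)) ∷ B→ (λ z → nx z ∧ na z) ∷
  B→ (λ z → not (nx z) ∧ na z) ∷ B→ (λ z → not (nx z) ∧ nb z ∧ not (na z)) ∷
  B→ (λ z → not (nx z) ∧ nc z ∧ not (nb z)) ∷ B→ (λ z → not (nx z) ∧ not (nc z)) ∷ []

-- The part of the first pass of `endingBlocks` through `A` that the second pass reverses exactly.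
-- The letters `p` and `x` stay outside: the last permutation ends in `p x`, because `x` must come
-- last to be broken alone at the end of the word.
turnA : ∀ {n} (p x a b c : Fin n → Bool) → List (Block n)
turnA p x a b c =
  A→ (λ z → not (p z) ∧ not (x z) ∧ not (a z) ∧ not (b z) ∧ not (c z)) ∷ A→ c ∷ A→ b ∷ A→ a ∷ []

-- The last two permutations of A, c b a | a b c being the turn between them. A vertex z of B not adjacent to x is cut
-- to the right of the turn and, at the end of the word, before x; one adjacent to x is cut to the left of the turn
-- and after x. Hence the two passes through B are exactly opposite.
endingBlocks : ∀ {n} (p x a b c nx na nb nc : Fin n → Bool) → List (Block n)
endingBlocks p x a b c nx na nb nc =
  A→ x ∷ A→ (λ z → not (p z) ∧ not (x z) ∧ not (a z) ∧ not (b z) ∧ not (c z)) ∷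
  B→ (λ z → nx z ∧ not (nc z)) ∷ A→ c ∷
  B→ (λ z → nx z ∧ nc z ∧ not (nb z)) ∷ A→ b ∷
  B→ (λ z → nx z ∧ nb z ∧ not (na z)) ∷ A→ a ∷
  B→ (λ z → nx z ∧ na z) ∷
  B→ (λ z → not (nx z) ∧ na z) ∷ A← a ∷
  B→ (λ z → not (nx z) ∧ nb z ∧ not (na z)) ∷ A← b ∷
  B→ (λ z → not (nx z) ∧ nc z ∧ not (nb z)) ∷ A← c ∷
  B→ (λ z → not (nx z) ∧ not (nc z)) ∷
  A← (λ z → not (p z) ∧ not (x z) ∧ not (a z) ∧ not (b z) ∧ not (c z)) ∷ A→ p ∷
  B← (λ z → not (nx z) ∧ not (nc z)) ∷ B← (λ z → not (nx z) ∧ nc z ∧ not (nb z)) ∷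
  B← (λ z → not (nx z) ∧ nb z ∧ not (na z)) ∷ B← (λ z → not (nx z) ∧ na z) ∷
  A→ x ∷
  B← (λ z → nx z ∧ na z) ∷ B← (λ z → nx z ∧ nb z ∧ not (na z)) ∷
  B← (λ z → nx z ∧ nc z ∧ not (nb z)) ∷ B← (λ z → nx z ∧ not (nc z)) ∷ []

data AllFalse : List Bool → Set where
  []  : AllFalse []
  off : ∀ {bs} → AllFalse bs → AllFalse (false ∷ bs)

-- A vertex of `A` enters a trace only through its equality tests against the named letters. These
-- are distinct, so at most one test succeeds, and the claims about gadgets become short truth
-- tables.
data AtMostOne : List Bool → Set where
  []   : AtMostOne []
  hit  : ∀ {bs} → AllFalse bs → AtMostOne (true ∷ bs)
  miss : ∀ {bs} → AtMostOne bs → AtMostOne (false ∷ bs)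

pattern only₁ = hit (off (off []))
pattern only₂ = miss (hit (off []))
pattern only₃ = miss (miss (hit []))
pattern none₃ = miss (miss (miss []))

pattern onlyP = hit (off (off (off (off []))))
pattern onlyX = miss (hit (off (off (off []))))
pattern onlyA = miss (miss (hit (off (off []))))
pattern onlyB = miss (miss (miss (hit (off []))))
pattern onlyC = miss (miss (miss (miss (hit []))))
pattern none₅ = miss (miss (miss (miss (miss []))))

-- The possible adjacencies of a vertex of B to a, b, c when N(a) ⊆ N(b) ⊆ N(c).
data Nested : Bool → Bool → Bool → Set where
  ⟨abc⟩ : Nested true true true
  ⟨bc⟩  : Nested false true true
  ⟨c⟩   : Nested false false true
  ⟨∅⟩   : Nested false false false

nested : ∀ {na nb nc} → na ≤ᵇ nb → nb ≤ᵇ nc → Nested na nb nc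
nested f≤t b≤b = ⟨bc⟩
nested {false} b≤b f≤t = ⟨c⟩
nested {false} b≤b b≤b = ⟨∅⟩
nested {true}  b≤b b≤b = ⟨abc⟩

all-false : ∀ {n} {y : Fin n} {zs} → All (y ≢_) zs → AllFalse (map (y ==_) zs)
all-false [] = []
all-false (y≢z ∷ y≢zs) rewrite ≢⇒==false y≢z = off (all-false y≢zs)

at-most-one : ∀ {n} (y : Fin n) {zs} → Unique zs → AtMostOne (map (y ==_) zs)
at-most-one y [] = []
at-most-one y (_∷_ {z} z∉zs uniq) with y ≟ z
... | yes refl = hit (all-false z∉zs)
... | no  _    = miss (at-most-one y uniq)

module _ {n : ℕ} (y z : Fin n) where

  private
    -- Traces and counts evaluate the marks only at `y` or `z`. Constant marks therefore expose the
    -- Booleans to case analysis, and the results apply to the actual marks by computation.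
    K : Bool → Fin n → Bool
    K s _ = s

  -- The starting letter `p` was written before the gadget, and the final `u` already belongs to the
  -- next permutation. Adding `p` on the left and leaving `u` over on the right makes the identities
  -- for consecutive gadgets telescope; `gadget-alternates` has the same form.
  gadget-count-A : ∀ {p u v nu nv} → AtMostOne (p ∷ u ∷ v ∷ []) →
    indicator p + count true y (gadgetBlocks (K p) (K u) (K v) nu nv) ≡ 1 + indicator u
  gadget-count-A only₁ = refl
  gadget-count-A only₂ = refl
  gadget-count-A only₃ = refl
  gadget-count-A none₃ = refl

  gadget-count-B : ∀ {p u v} nu nv → count false z (gadgetBlocks p u v (K nu) (K nv)) ≡ 1
  gadget-count-B true  true  = refl
  gadget-count-B true  false = refl
  gadget-count-B false true  = refl
  gadget-count-B false false = refl

  gadget-alternates : ∀ {p u v} nu nv → AtMostOne (p ∷ u ∷ v ∷ []) → u ≤ᵇ nu → v ≤ᵇ nv →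
    letter true p ++ trace y z (gadgetBlocks (K p) (K u) (K v) (K nu) (K nv)) ≡ true ∷ false ∷ letter true u
  gadget-alternates true  true  only₁ _ _ = refl
  gadget-alternates true  false only₁ _ _ = refl
  gadget-alternates false true  only₁ _ _ = refl
  gadget-alternates false false only₁ _ _ = refl
  gadget-alternates true  true  only₂ _ _ = refl
  gadget-alternates true  false only₂ _ _ = refl
  gadget-alternates true  true  only₃ _ _ = refl
  gadget-alternates false true  only₃ _ _ = refl
  gadget-alternates true  true  none₃ _ _ = refl
  gadget-alternates true  false none₃ _ _ = refl
  gadget-alternates false true  none₃ _ _ = refl
  gadget-alternates false false none₃ _ _ = refl

  -- A non-neighbour of `u` is cut before the first `u` or after the second, so nothing separates
  -- the two copies of `u` in the trace.
  gadget-repeats-u : ∀ {p u v nu} nv → AtMostOne (p ∷ u ∷ v ∷ []) → u ≡ true → nu ≡ false →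
    Repeats (trace y z (gadgetBlocks (K p) (K u) (K v) (K nu) (K nv)))
  gadget-repeats-u true  only₂ refl refl = now
  gadget-repeats-u false only₂ refl refl = later now

  -- A non-neighbour of `v` is cut before `v`, and the letter that `v` doubles is its copy in the
  -- next permutation. The appended `true` is that copy.
  gadget-repeats-v : ∀ {p u v nv} nu {ts} → AtMostOne (p ∷ u ∷ v ∷ []) → v ≡ true → nv ≡ false →
    Repeats (trace y z (gadgetBlocks (K p) (K u) (K v) (K nu) (K nv)) ++ true ∷ ts)
  gadget-repeats-v true  only₃ refl refl = later now
  gadget-repeats-v false only₃ refl refl = later now
  gadget-repeats-v _ (hit (off ())) refl _

  ending-count-A : ∀ {p x a b c nx na nb nc} → AtMostOne (p ∷ x ∷ a ∷ b ∷ c ∷ []) →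
    indicator p + count true y (endingBlocks (K p) (K x) (K a) (K b) (K c) nx na nb nc) ≡ 2
  ending-count-A onlyP = refl
  ending-count-A onlyX = refl
  ending-count-A onlyA = refl
  ending-count-A onlyB = refl
  ending-count-A onlyC = refl
  ending-count-A none₅ = refl

  -- The two values of `nx` and the four cases of `Nested` index the eight blocks of `turnB`, so
  -- each vertex of `B` lies in exactly one of them.
  ending-count-B : ∀ {p x a b c na nb nc} nx → Nested na nb nc →
    count false z (turnB (K nx) (K na) (K nb) (K nc)) ≡ 1 ×
    count false z (endingBlocks p x a b c (K nx) (K na) (K nb) (K nc)) ≡ 2
  ending-count-B true  ⟨abc⟩ = refl , refl
  ending-count-B true  ⟨bc⟩  = refl , refl
  ending-count-B true  ⟨c⟩   = refl , refl
  ending-count-B true  ⟨∅⟩   = refl , refl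
  ending-count-B false ⟨abc⟩ = refl , refl
  ending-count-B false ⟨bc⟩  = refl , refl
  ending-count-B false ⟨c⟩   = refl , refl
  ending-count-B false ⟨∅⟩   = refl , refl

  turnA-count : ∀ {p x a b c} → AtMostOne (p ∷ x ∷ a ∷ b ∷ c ∷ []) → p ≡ false → x ≡ false →
    count true y (turnA (K p) (K x) (K a) (K b) (K c)) ≡ 1
  turnA-count onlyA refl refl = refl
  turnA-count onlyB refl refl = refl
  turnA-count onlyC refl refl = refl
  turnA-count none₅ refl refl = refl

  ending-alternates : ∀ {p x a b c na nb nc} nx → AtMostOne (p ∷ x ∷ a ∷ b ∷ c ∷ []) → Nested na nb nc →
    x ≤ᵇ nx → a ≤ᵇ na → b ≤ᵇ nb → c ≤ᵇ nc →
    letter true p ++ trace y z (endingBlocks (K p) (K x) (K a) (K b) (K c) (K nx) (K na) (K nb) (K nc))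
      ≡ true ∷ false ∷ true ∷ false ∷ []
  ending-alternates true  onlyP ⟨abc⟩ _ _ _ _ = refl
  ending-alternates true  onlyP ⟨bc⟩  _ _ _ _ = refl
  ending-alternates true  onlyP ⟨c⟩   _ _ _ _ = refl
  ending-alternates true  onlyP ⟨∅⟩   _ _ _ _ = refl
  ending-alternates false onlyP ⟨abc⟩ _ _ _ _ = refl
  ending-alternates false onlyP ⟨bc⟩  _ _ _ _ = refl
  ending-alternates false onlyP ⟨c⟩   _ _ _ _ = refl
  ending-alternates false onlyP ⟨∅⟩   _ _ _ _ = refl
  ending-alternates true  onlyX ⟨abc⟩ _ _ _ _ = refl
  ending-alternates true  onlyX ⟨bc⟩  _ _ _ _ = refl
  ending-alternates true  onlyX ⟨c⟩   _ _ _ _ = refl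
  ending-alternates true  onlyX ⟨∅⟩   _ _ _ _ = refl
  ending-alternates true  onlyA ⟨abc⟩ _ _ _ _ = refl
  ending-alternates false onlyA ⟨abc⟩ _ _ _ _ = refl
  ending-alternates true  onlyB ⟨abc⟩ _ _ _ _ = refl
  ending-alternates true  onlyB ⟨bc⟩  _ _ _ _ = refl
  ending-alternates false onlyB ⟨abc⟩ _ _ _ _ = refl
  ending-alternates false onlyB ⟨bc⟩  _ _ _ _ = refl
  ending-alternates true  onlyC ⟨abc⟩ _ _ _ _ = refl
  ending-alternates true  onlyC ⟨bc⟩  _ _ _ _ = refl
  ending-alternates true  onlyC ⟨c⟩   _ _ _ _ = refl
  ending-alternates false onlyC ⟨abc⟩ _ _ _ _ = refl
  ending-alternates false onlyC ⟨bc⟩  _ _ _ _ = refl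
  ending-alternates false onlyC ⟨c⟩   _ _ _ _ = refl
  ending-alternates true  none₅ ⟨abc⟩ _ _ _ _ = refl
  ending-alternates true  none₅ ⟨bc⟩  _ _ _ _ = refl
  ending-alternates true  none₅ ⟨c⟩   _ _ _ _ = refl
  ending-alternates true  none₅ ⟨∅⟩   _ _ _ _ = refl
  ending-alternates false none₅ ⟨abc⟩ _ _ _ _ = refl
  ending-alternates false none₅ ⟨bc⟩  _ _ _ _ = refl
  ending-alternates false none₅ ⟨c⟩   _ _ _ _ = refl
  ending-alternates false none₅ ⟨∅⟩   _ _ _ _ = refl

  -- Here the doubled letter is `z`: both its copies fall between the two copies of `x`.
  ending-repeats-x : ∀ {p x a b c nx na nb nc} → AtMostOne (p ∷ x ∷ a ∷ b ∷ c ∷ []) → Nested na nb nc →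
    x ≡ true → nx ≡ false →
    Repeats (trace y z (endingBlocks (K p) (K x) (K a) (K b) (K c) (K nx) (K na) (K nb) (K nc)))
  ending-repeats-x onlyX ⟨abc⟩ refl refl = later now
  ending-repeats-x onlyX ⟨bc⟩  refl refl = later now
  ending-repeats-x onlyX ⟨c⟩   refl refl = later now
  ending-repeats-x onlyX ⟨∅⟩   refl refl = later now

  -- The two copies of `a` around the turn stay together, because `nx` puts `z` either before both
  -- or after both. The same happens for `b` and `c`.
  ending-repeats-a : ∀ {p x a b c na nb nc} nx → AtMostOne (p ∷ x ∷ a ∷ b ∷ c ∷ []) → Nested na nb nc →
    a ≡ true → na ≡ false →
    Repeats (trace y z (endingBlocks (K p) (K x) (K a) (K b) (K c) (K nx) (K na) (K nb) (K nc)))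
  ending-repeats-a true  onlyA ⟨bc⟩ refl refl = later now
  ending-repeats-a true  onlyA ⟨c⟩  refl refl = later now
  ending-repeats-a true  onlyA ⟨∅⟩  refl refl = later now
  ending-repeats-a false onlyA ⟨bc⟩ refl refl = now
  ending-repeats-a false onlyA ⟨c⟩  refl refl = now
  ending-repeats-a false onlyA ⟨∅⟩  refl refl = now
  ending-repeats-a _ (hit (off ())) _ refl _

  ending-repeats-b : ∀ {p x a b c na nb nc} nx → AtMostOne (p ∷ x ∷ a ∷ b ∷ c ∷ []) → Nested na nb nc →
    b ≡ true → nb ≡ false →
    Repeats (trace y z (endingBlocks (K p) (K x) (K a) (K b) (K c) (K nx) (K na) (K nb) (K nc)))
  ending-repeats-b true  onlyB ⟨c⟩ refl refl = later now
  ending-repeats-b true  onlyB ⟨∅⟩ refl refl = later now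
  ending-repeats-b false onlyB ⟨c⟩ refl refl = now
  ending-repeats-b false onlyB ⟨∅⟩ refl refl = now
  ending-repeats-b _ (hit (off (off ()))) _ refl _
  ending-repeats-b _ (miss (hit (off ()))) _ refl _

  ending-repeats-c : ∀ {p x a b c na nb nc} nx → AtMostOne (p ∷ x ∷ a ∷ b ∷ c ∷ []) → Nested na nb nc →
    c ≡ true → nc ≡ false →
    Repeats (trace y z (endingBlocks (K p) (K x) (K a) (K b) (K c) (K nx) (K na) (K nb) (K nc)))
  ending-repeats-c true  onlyC ⟨∅⟩ refl refl = later now
  ending-repeats-c false onlyC ⟨∅⟩ refl refl = now
  ending-repeats-c _ (hit (off (off (off ())))) _ refl _
  ending-repeats-c _ (miss (hit (off (off ())))) _ refl _
  ending-repeats-c _ (miss (miss (hit (off ())))) _ refl _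

-- The representing word

flatten : ∀ {A : Set} → List (A × A) → List A
flatten []             = []
flatten ((u , v) ∷ qs) = u ∷ v ∷ flatten qs

zigzag : ℕ → List Bool
zigzag 0       = []
zigzag (suc k) = true ∷ false ∷ zigzag k

Linked-zigzag : ∀ {A : Set} {y b : A} → y ≢ b → ∀ k → Linked _≢_ (map (pick y b) (zigzag k))
Linked-zigzag y≢b 0             = []
Linked-zigzag y≢b 1             = y≢b ∷ [-]
Linked-zigzag y≢b (suc (suc k)) = y≢b ∷ ≢-sym y≢b ∷ Linked-zigzag y≢b (suc k)

module Representation {n : ℕ} (G : Graph n) (side : Fin n → Bool) (bip : IsBipartition G side)
  (x a b c : Fin n) (Na⊆Nb : NbhdSub G a b) (Nb⊆Nc : NbhdSub G b c) where

  open Words side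

  nbr : Fin n → Fin n → Bool
  nbr u z = adj G z u

  gadget : (p u v : Fin n) → List (Block n)
  gadget p u v = gadgetBlocks (_== p) (_== u) (_== v) (nbr u) (nbr v)

  ending : Fin n → List (Block n)
  ending p = endingBlocks (_== p) (_== x) (_== a) (_== b) (_== c) (nbr x) (nbr a) (nbr b) (nbr c)

  -- Each gadget writes the first letter of the following permutation, so its `u` becomes the next
  -- `p`, and the last `u` goes to `ending`. Every pair completes one permutation of `A` and
  -- `ending` completes two; as `qs` omits the first pair, this gives `3 + length qs`.
  body : Fin n → Fin n × Fin n → List (Fin n × Fin n) → List (Block n)
  body p (u , v) []       = gadget p u v ++ ending u
  body p (u , v) (q ∷ qs) = gadget p u v ++ body u q qs

  nbr-mono : ∀ {u v} → NbhdSub G u v → ∀ z → nbr u z ≤ᵇ nbr v z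
  nbr-mono {u} {v} sub z with adj G z u in eu | adj G z v in ev
  ... | false | false = b≤b
  ... | false | true  = f≤t
  ... | true  | true  = b≤b
  ... | true  | false with () ← trans (sym (sub z (trans (adj-sym G u z) eu))) (trans (adj-sym G v z) ev)

  nested-nbr : ∀ z → Nested (nbr a z) (nbr b z) (nbr c z)
  nested-nbr z = nested (nbr-mono Na⊆Nb z) (nbr-mono Nb⊆Nc z)

  ==-≤-nbr : ∀ {y z} → nbr y z ≡ true → ∀ u → y == u ≤ᵇ nbr u z
  ==-≤-nbr {y} {z} e u with y ≟ u
  ... | yes refl rewrite e = b≤b
  ... | no  _ with nbr u z
  ...   | true  = f≤t
  ...   | false = b≤b

  Distinct : Fin n × Fin n → List (Fin n × Fin n) → Set
  Distinct q qs = Unique (flatten (q ∷ qs) ++ x ∷ a ∷ b ∷ c ∷ [])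

  -- Kept apart from `Distinct` because the first gadget takes `a` as its `p`, and `a` is already in
  -- that list.
  AvoidsPair : Fin n → Fin n × Fin n → Set
  AvoidsPair p (u , v) = p ≢ u × p ≢ v

  one-of-gadget : ∀ {p u v} y qs → AvoidsPair p (u , v) → Distinct (u , v) qs →
                  AtMostOne (y == p ∷ y == u ∷ y == v ∷ [])
  one-of-gadget y qs (p≢u , p≢v) ((u≢v ∷ _) ∷ _) =
    at-most-one y ((p≢u ∷ p≢v ∷ []) ∷ (u≢v ∷ []) ∷ [] ∷ [])

  one-of-ending : ∀ {u v} y → Distinct (u , v) [] →
                  AtMostOne (y == u ∷ y == x ∷ y == a ∷ y == b ∷ y == c ∷ [])
  one-of-ending y ((_ ∷ u∉) ∷ _ ∷ rest) = at-most-one y (u∉ ∷ rest)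

  next-avoids : ∀ {u v q qs} → Distinct (u , v) (q ∷ qs) → AvoidsPair u q
  next-avoids ((_ ∷ u≢u′ ∷ u≢v′ ∷ _) ∷ _) = u≢u′ , u≢v′

  next-distinct : ∀ {u v q qs} → Distinct (u , v) (q ∷ qs) → Distinct q qs
  next-distinct (_ ∷ _ ∷ rest) = rest

  body-count-A : ∀ y p q qs → AvoidsPair p q → Distinct q qs →
                 indicator (y == p) + count true y (body p q qs) ≡ 3 + length qs
  body-count-A y p (u , v) [] av d = trans (cong (indicator (y == p) +_) (count-++ true y (gadget p u v) (ending u)))
    (trans (sym (+-assoc (indicator (y == p)) _ _))
    (trans (cong (_+ count true y (ending u)) (gadget-count-A y y {nu = nbr u} {nbr v} (one-of-gadget y [] av d)))
           (cong suc (ending-count-A y y {nx = nbr x} {nbr a} {nbr b} {nbr c} (one-of-ending y d)))))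
  body-count-A y p (u , v) (q ∷ qs) av d = trans (cong (indicator (y == p) +_) (count-++ true y (gadget p u v) (body u q qs)))
    (trans (sym (+-assoc (indicator (y == p)) _ _))
    (trans (cong (_+ count true y (body u q qs)) (gadget-count-A y y {nu = nbr u} {nbr v} (one-of-gadget y (q ∷ qs) av d)))
           (cong suc (body-count-A y u q qs (next-avoids d) (next-distinct d)))))

  body-count-B : ∀ z p q qs → count false z (body p q qs) ≡ 3 + length qs
  body-count-B z p (u , v) [] = trans (count-++ false z (gadget p u v) (ending u))
    (cong₂ _+_ (gadget-count-B z z {_== p} {_== u} {_== v} (nbr u z) (nbr v z)) (proj₂ (ending-count-B z z {_== u} {_== x} {_== a} {_== b} {_== c} (nbr x z) (nested-nbr z))))
  body-count-B z p (u , v) (q ∷ qs) = trans (count-++ false z (gadget p u v) (body u q qs))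
    (cong₂ _+_ (gadget-count-B z z {_== p} {_== u} {_== v} (nbr u z) (nbr v z)) (body-count-B z u q qs))

  body-alternates : ∀ {y z} → nbr y z ≡ true → ∀ p q qs → AvoidsPair p q → Distinct q qs →
                    letter true (y == p) ++ trace y z (body p q qs) ≡ zigzag (3 + length qs)
  body-alternates {y} {z} e p (u , v) [] av d =
    trans (cong (letter true (y == p) ++_) (trace-++ y z (gadget p u v) (ending u)))
    (trans (sym (++-assoc (letter true (y == p)) _ _))
    (trans (cong (_++ trace y z (ending u))
              (gadget-alternates y z (nbr u z) (nbr v z) (one-of-gadget y [] av d) (==-≤-nbr e u) (==-≤-nbr e v)))
           (cong (λ l → true ∷ false ∷ l)
              (ending-alternates y z (nbr x z) (one-of-ending y d) (nested-nbr z)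
                (==-≤-nbr e x) (==-≤-nbr e a) (==-≤-nbr e b) (==-≤-nbr e c)))))
  body-alternates {y} {z} e p (u , v) (q ∷ qs) av d =
    trans (cong (letter true (y == p) ++_) (trace-++ y z (gadget p u v) (body u q qs)))
    (trans (sym (++-assoc (letter true (y == p)) _ _))
    (trans (cong (_++ trace y z (body u q qs))
              (gadget-alternates y z (nbr u z) (nbr v z) (one-of-gadget y (q ∷ qs) av d) (==-≤-nbr e u) (==-≤-nbr e v)))
           (cong (λ l → true ∷ false ∷ l) (body-alternates e u q qs (next-avoids d) (next-distinct d)))))

  -- Provides the second copy of `v` for `gadget-repeats-v`: a letter not named in the next gadget
  -- lies in its opening block, ahead of every block of `B`.
  trace-gadget-head : ∀ {y p u v} z → y ≢ p → y ≢ u → y ≢ v → ∃[ ts ] trace y z (gadget p u v) ≡ true ∷ ts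
  trace-gadget-head z y≢p y≢u y≢v rewrite ≢⇒==false y≢p | ≢⇒==false y≢u | ≢⇒==false y≢v = _ , refl

  trace-ending-head : ∀ {y p} z → y ≢ p → All (y ≢_) (x ∷ a ∷ b ∷ c ∷ []) → ∃[ ts ] trace y z (ending p) ≡ true ∷ ts
  trace-ending-head z y≢p (y≢x ∷ y≢a ∷ y≢b ∷ y≢c ∷ [])
    rewrite ≢⇒==false y≢p | ≢⇒==false y≢x | ≢⇒==false y≢a | ≢⇒==false y≢b | ≢⇒==false y≢c = _ , refl

  trace-body-head : ∀ {y} z p q qs → y ≢ p → All (y ≢_) (flatten (q ∷ qs) ++ x ∷ a ∷ b ∷ c ∷ []) →
                    ∃[ ts ] trace y z (body p q qs) ≡ true ∷ ts
  trace-body-head {y} z p (u , v) [] y≢p (y≢u ∷ y≢v ∷ _) =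
    _ , trans (trace-++ y z (gadget p u v) (ending u))
              (cong (_++ trace y z (ending u)) (proj₂ (trace-gadget-head z y≢p y≢u y≢v)))
  trace-body-head {y} z p (u , v) (q ∷ qs) y≢p (y≢u ∷ y≢v ∷ _) =
    _ , trans (trace-++ y z (gadget p u v) (body u q qs))
              (cong (_++ trace y z (body u q qs)) (proj₂ (trace-gadget-head z y≢p y≢u y≢v)))

  ending-repeats : ∀ {y z u v} → nbr y z ≡ false → Distinct (u , v) [] → y ∈ x ∷ a ∷ b ∷ c ∷ [] →
                   Repeats (trace y z (ending u))
  ending-repeats {y} {z} e d (here refl) =
    ending-repeats-x y z (one-of-ending y d) (nested-nbr z) (≡⇒==true {y = y} refl) e
  ending-repeats {y} {z} e d (there (here refl)) =
    ending-repeats-a y z (nbr x z) (one-of-ending y d) (nested-nbr z) (≡⇒==true {y = y} refl) e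
  ending-repeats {y} {z} e d (there (there (here refl))) =
    ending-repeats-b y z (nbr x z) (one-of-ending y d) (nested-nbr z) (≡⇒==true {y = y} refl) e
  ending-repeats {y} {z} e d (there (there (there (here refl)))) =
    ending-repeats-c y z (nbr x z) (one-of-ending y d) (nested-nbr z) (≡⇒==true {y = y} refl) e

  body-repeats : ∀ {y z} → nbr y z ≡ false → ∀ p q qs → AvoidsPair p q → Distinct q qs →
                 y ∈ flatten (q ∷ qs) ++ x ∷ a ∷ b ∷ c ∷ [] → Repeats (trace y z (body p q qs))
  body-repeats {y} {z} e p (u , v) [] av d (here refl) =
    subst Repeats (sym (trace-++ y z (gadget p u v) (ending u)))
      (Repeats-++ˡ _ (gadget-repeats-u y z (nbr v z) (one-of-gadget y [] av d) (≡⇒==true {y = y} refl) e))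
  body-repeats {y} {z} e p (u , v) [] av d@((u≢v ∷ _) ∷ v∉ ∷ _) (there (here refl)) =
    subst Repeats (sym (trans (trace-++ y z (gadget p u v) (ending u))
                              (cong (trace y z (gadget p u v) ++_) (proj₂ (trace-ending-head z (≢-sym u≢v) v∉)))))
      (gadget-repeats-v y z (nbr u z) (one-of-gadget y [] av d) (≡⇒==true {y = y} refl) e)
  body-repeats {y} {z} e p (u , v) [] av d (there (there y∈)) =
    subst Repeats (sym (trace-++ y z (gadget p u v) (ending u)))
      (Repeats-++ʳ (trace y z (gadget p u v)) (ending-repeats e d y∈))
  body-repeats {y} {z} e p (u , v) (q ∷ qs) av d (here refl) =
    subst Repeats (sym (trace-++ y z (gadget p u v) (body u q qs)))
      (Repeats-++ˡ _ (gadget-repeats-u y z (nbr v z) (one-of-gadget y (q ∷ qs) av d) (≡⇒==true {y = y} refl) e))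
  body-repeats {y} {z} e p (u , v) (q ∷ qs) av d@((u≢v ∷ _) ∷ v∉ ∷ _) (there (here refl)) =
    subst Repeats (sym (trans (trace-++ y z (gadget p u v) (body u q qs))
                              (cong (trace y z (gadget p u v) ++_) (proj₂ (trace-body-head z u q qs (≢-sym u≢v) v∉)))))
      (gadget-repeats-v y z (nbr u z) (one-of-gadget y (q ∷ qs) av d) (≡⇒==true {y = y} refl) e)
  body-repeats {y} {z} e p (u , v) (q ∷ qs) av d (there (there y∈)) =
    subst Repeats (sym (trace-++ y z (gadget p u v) (body u q qs)))
      (Repeats-++ʳ (trace y z (gadget p u v)) (body-repeats e u q qs (next-avoids d) (next-distinct d) y∈))

  Repeats-comm : ∀ (y z : Fin n) w → Repeats (restrict y z w) → Repeats (restrict z y w)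
  Repeats-comm y z w = subst Repeats (restrict-comm y z w)

  Repeats-wordˡ : ∀ {y z} βs γs → Repeats (restrict y z (word βs)) → Repeats (restrict y z (word (βs ++ γs)))
  Repeats-wordˡ {y} {z} βs γs r rewrite word-++ βs γs | restrict-++ y z (word βs) (word γs) = Repeats-++ˡ _ r

  Repeats-wordʳ : ∀ {y z} βs γs → Repeats (restrict y z (word γs)) → Repeats (restrict y z (word (βs ++ γs)))
  Repeats-wordʳ {y} {z} βs γs r rewrite word-++ βs γs | restrict-++ y z (word βs) (word γs) = Repeats-++ʳ (restrict y z (word βs)) r

  -- All of `A` except `u` and `x` lies in the palindrome around the turn. It suffices that one
  -- letter of the pair does, since the letter nearest to the turn is doubled.
  ending-repeats-A : ∀ {y z u v} → side y ≡ true → side z ≡ true → Distinct (u , v) [] → y ≢ u → y ≢ x →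
                     Repeats (restrict y z (word (ending u)))
  ending-repeats-A {y} {z} {u} sy sz d y≢u y≢x = palindrome sy sz (ending u)
    [ A→ (_== x) ] (turnA (_== u) (_== x) (_== a) (_== b) (_== c)) [] (A→ (_== u) ∷ A→ (_== x) ∷ [])
    refl (1⇒≢0 (turnA-count y z (one-of-ending y d) (≢⇒==false y≢u) (≢⇒==false y≢x))) refl refl
    where
    1⇒≢0 : ∀ {m} → m ≡ 1 → m ≢ 0
    1⇒≢0 refl ()

  -- Once `v` is ignored, the end `u v u` reads `u u`. The second `u` is written as `A← u` so that
  -- it is literally the mirror of `A→ u`.
  gadget-repeats-A : ∀ {u z v} p → side u ≡ true → side z ≡ true → u ≢ v → z ≢ v →
                     Repeats (restrict u z (word (gadget p u v)))
  gadget-repeats-A {u} {z} {v} p su sz u≢v z≢v = palindrome su sz (gadget p u v)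
    [ A→ (λ z → not (z == p) ∧ not (z == u) ∧ not (z == v)) ] [ A→ (_== u) ] [ A→ (_== v) ] []
    refl u-counted (absent u≢v) (absent z≢v)
    where
    u-counted : count true u [ A→ (_== u) ] ≢ 0
    u-counted rewrite ≡⇒==true {y = u} refl = λ ()
    absent : ∀ {y} → y ≢ v → count true y [ A→ (_== v) ] ≡ 0
    absent y≢v rewrite ≢⇒==false y≢v = refl

  body-repeats-A : ∀ {y z} → side y ≡ true → side z ≡ true → y ≢ z → ∀ p q qs → Distinct q qs →
                   Repeats (restrict y z (word (body p q qs)))
  body-repeats-A sy sz y≢z p (u , v) (q ∷ qs) d =
    Repeats-wordʳ (gadget p u v) (body u q qs) (body-repeats-A sy sz y≢z u q qs (next-distinct d))
  body-repeats-A {y} {z} sy sz y≢z p (u , v) [] d@((u≢v ∷ _) ∷ (v≢x ∷ _) ∷ _) =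
    -- The turn handles every pair except `u`, `x`, whose order is the same in the last two
    -- permutations; the last gadget handles that one.
    cases (y ≟ u) (y ≟ x) (z ≟ u) (z ≟ x)
    where
    in-gadget : ∀ {y z} → side y ≡ true → side z ≡ true → y ≡ u → z ≡ x → Repeats (restrict y z (word (body p (u , v) [])))
    in-gadget sy sz refl refl = Repeats-wordˡ (gadget p u v) (ending u) (gadget-repeats-A p sy sz u≢v (≢-sym v≢x))
    in-ending : ∀ {y z} → side y ≡ true → side z ≡ true → y ≢ u → y ≢ x → Repeats (restrict y z (word (body p (u , v) [])))
    in-ending sy sz y≢u y≢x = Repeats-wordʳ (gadget p u v) (ending u) (ending-repeats-A sy sz d y≢u y≢x)
    cases : Dec (y ≡ u) → Dec (y ≡ x) → Dec (z ≡ u) → Dec (z ≡ x) → Repeats (restrict y z (word (body p (u , v) [])))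
    cases (no y≢u)  (no y≢x)  _         _         = in-ending sy sz y≢u y≢x
    cases _         _         (no z≢u)  (no z≢x)  = Repeats-comm z y (word (body p (u , v) [])) (in-ending sz sy z≢u z≢x)
    cases (yes y≡u) _         (yes z≡u) _         = ⊥-elim (y≢z (trans y≡u (sym z≡u)))
    cases _         (yes y≡x) _         (yes z≡x) = ⊥-elim (y≢z (trans y≡x (sym z≡x)))
    cases (yes y≡u) _         _         (yes z≡x) = in-gadget sy sz y≡u z≡x
    cases _         (yes y≡x) (yes z≡u) _         = Repeats-comm z y (word (body p (u , v) [])) (in-gadget sz sy z≡u y≡x)

  -- The blocks of `B` in `ending u` are `turnB` followed by its mirror, by computation, and every
  -- vertex of `B` occurs in `turnB`.
  body-repeats-B : ∀ {y z} → side y ≡ false → side z ≡ false → ∀ p q qs →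
                   Repeats (restrict y z (word (body p q qs)))
  body-repeats-B sy sz p (u , v) (q ∷ qs) =
    Repeats-wordʳ (gadget p u v) (body u q qs) (body-repeats-B sy sz u q qs)
  body-repeats-B {y} {z} sy sz p (u , v) [] = Repeats-wordʳ (gadget p u v) (ending u)
    (palindrome sy sz (ending u) [] (turnB (nbr x) (nbr a) (nbr b) (nbr c)) [] [] refl counted refl refl)
    where
    counted : count false y (turnB (nbr x) (nbr a) (nbr b) (nbr c)) ≢ 0
    counted e with () ← trans (sym e) (proj₁ (ending-count-B y y {_== u} {_== x} {_== a} {_== b} {_== c} (nbr x y) (nested-nbr y)))

  avoids : ∀ {u v qs} → Distinct (u , v) qs → AvoidsPair a (u , v)
  avoids {qs = qs} (u∉ ∷ v∉ ∷ _) = ≢-sym (All.lookup u∉ (there a∈)) , ≢-sym (All.lookup v∉ a∈)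
    where
    a∈ : a ∈ flatten qs ++ x ∷ a ∷ b ∷ c ∷ []
    a∈ = ∈-++⁺ʳ (flatten qs) (there (here refl))

  module _ (u v : Fin n) (qs : List (Fin n × Fin n)) (d : Distinct (u , v) qs)
    (A⊆ : ∀ {y} → side y ≡ true → y ∈ flatten ((u , v) ∷ qs) ++ x ∷ a ∷ b ∷ c ∷ []) where

    -- The first permutation also needs its starting letter written in advance; `a` serves, being
    -- outside the first pair.
    blocks : List (Block n)
    blocks = A→ (_== a) ∷ body a (u , v) qs

    a-avoids : AvoidsPair a (u , v)
    a-avoids = avoids {qs = qs} d

    uniform : Uniform (3 + length qs) (word blocks)
    uniform y with side y in sy
    ... | true  = trans (occ-word sy blocks) (body-count-A y a (u , v) qs a-avoids d)
    ... | false = trans (occ-word sy blocks) (body-count-B y a (u , v) qs)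

    alternate-AB : ∀ {y z} → side y ≡ true → side z ≡ false → nbr y z ≡ true ⇔ Alternate y z (word blocks)
    alternate-AB {y} {z} sy sz = mk⇔
      (λ e → subst (Linked _≢_) (sym (trans (restrict-word sy sz blocks)
                (cong (map (pick y z)) (body-alternates e a (u , v) qs a-avoids d))))
                (Linked-zigzag y≢z (3 + length qs)))
      (λ alt → decidable-stable (nbr y z ≟ᵇ true) λ e → Repeats⇒¬Linked
                (subst Repeats (sym (restrict-word sy sz blocks)) (Repeats-map (pick y z)
                  (Repeats-++ʳ (letter true (y == a)) (body-repeats (¬-not e) a (u , v) qs a-avoids d (A⊆ sy))))) alt)
      where
      y≢z : y ≢ z
      y≢z refl with () ← trans (sym sy) sz

    ¬alternate-A : ∀ {y z} → side y ≡ true → side z ≡ true → y ≢ z → ¬ Alternate y z (word blocks)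
    ¬alternate-A sy sz y≢z = Repeats⇒¬Linked
      (Repeats-wordʳ [ A→ (_== a) ] (body a (u , v) qs) (body-repeats-A sy sz y≢z a (u , v) qs d))

    ¬alternate-B : ∀ {y z} → side y ≡ false → side z ≡ false → ¬ Alternate y z (word blocks)
    ¬alternate-B sy sz = Repeats⇒¬Linked
      (Repeats-wordʳ [ A→ (_== a) ] (body a (u , v) qs) (body-repeats-B sy sz a (u , v) qs))

    represents : Represents (word blocks) G
    represents = covers , alternation
      where
      3+≢0 : ∀ {m} → 3 + m ≢ 0
      3+≢0 ()
      covers : ∀ y → y ∈ word blocks
      covers y with side y in sy
      ... | true  = ∈-word sy blocks λ e → 3+≢0 (trans (sym (body-count-A y a (u , v) qs a-avoids d)) e)
      ... | false = ∈-word sy blocks λ e → 3+≢0 (trans (sym (body-count-B y a (u , v) qs)) e)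
      alternation : ∀ y z → y ≢ z → Adj G y z ⇔ Alternate y z (word blocks)
      alternation y z y≢z with side y in sy | side z in sz
      ... | true  | true  = mk⇔ (λ e → ⊥-elim (bip y z e (trans sy (sym sz)))) (⊥-elim ∘ ¬alternate-A sy sz y≢z)
      ... | false | false = mk⇔ (λ e → ⊥-elim (bip y z e (trans sy (sym sz)))) (⊥-elim ∘ ¬alternate-B sy sz)
      ... | true  | false = mk⇔ (Equivalence.to (alternate-AB sy sz) ∘ trans (adj-sym G z y))
                                (trans (adj-sym G y z) ∘ Equivalence.from (alternate-AB sy sz))
      ... | false | true  = mk⇔
        (subst (Linked _≢_) (restrict-comm z y (word blocks)) ∘ Equivalence.to (alternate-AB sz sy))
        (Equivalence.from (alternate-AB sz sy) ∘ subst (Linked _≢_) (restrict-comm y z (word blocks)))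

-- Choosing the chain and the pairs

-- If `q` is between `p` and `r`, the order is settled; if it is above both or below both, comparing
-- `p` with `r` decides.
sorted-triple : ∀ {n} {G : Graph n} {side} → HeightAtLeast G side 3 →
  ∃[ a ] ∃[ b ] ∃[ c ] (NbhdSub G a b × NbhdSub G b c × (a ≢ b × a ≢ c × b ≢ c) × (InA side a × InA side b × InA side c))
sorted-triple ((p ∷ q ∷ r ∷ _) , ((p≢q ∷ p≢r ∷ _) ∷ (q≢r ∷ _) ∷ _ , (Ap ∷ Aq ∷ Ar ∷ _) , (pq ∷ pr ∷ _) ∷ (qr ∷ _) ∷ _) , _)
  with pq | qr | pr
... | inj₁ p≤q | inj₁ q≤r | _        = p , q , r , p≤q , q≤r , (p≢q , p≢r , q≢r) , Ap , Aq , Ar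
... | inj₁ p≤q | inj₂ r≤q | inj₁ p≤r = p , r , q , p≤r , r≤q , (p≢r , p≢q , ≢-sym q≢r) , Ap , Ar , Aq
... | inj₁ p≤q | inj₂ r≤q | inj₂ r≤p = r , p , q , r≤p , p≤q , (≢-sym p≢r , ≢-sym q≢r , p≢q) , Ar , Ap , Aq
... | inj₂ q≤p | inj₂ r≤q | _        = r , q , p , r≤q , q≤p , (≢-sym q≢r , ≢-sym p≢r , ≢-sym p≢q) , Ar , Aq , Ap
... | inj₂ q≤p | inj₁ q≤r | inj₁ p≤r = q , p , r , q≤p , p≤r , (≢-sym p≢q , q≢r , p≢r) , Aq , Ap , Ar
... | inj₂ q≤p | inj₁ q≤r | inj₂ r≤p = q , r , p , q≤r , r≤p , (q≢r , ≢-sym p≢q , ≢-sym p≢r) , Aq , Ar , Ap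
sorted-triple ([] , _ , ())
sorted-triple ((_ ∷ []) , _ , s≤s ())
sorted-triple ((_ ∷ _ ∷ []) , _ , s≤s (s≤s ()))

∈⇒↭∷ : ∀ {A : Set} {y : A} {ys} → y ∈ ys → ∃[ zs ] ys ↭ y ∷ zs
∈⇒↭∷ {y = y} y∈ys with us , vs , refl ← ∈-∃++ y∈ys = us ++ vs , shift y us vs

∈-tail : ∀ {A : Set} {y z : A} {zs} → y ≢ z → y ∈ z ∷ zs → y ∈ zs
∈-tail y≢z (here y≡z)  = ⊥-elim (y≢z y≡z)
∈-tail y≢z (there y∈zs) = y∈zs

pair-up : ∀ {A : Set} k (ys : List A) → length ys ≡ 2 * k → ∃[ qs ] (ys ≡ flatten qs × length qs ≡ k)
pair-up 0 [] refl = [] , refl , refl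
pair-up (suc k) ys eq rewrite *-suc 2 k with ys | eq
... | u ∷ v ∷ ys′ | e with qs , refl , len ← pair-up k ys′ (suc-injective (suc-injective e)) =
  (u , v) ∷ qs , refl , cong suc len

theorem4 : ∀ {n} (G : Graph n) (side : Fin n → Bool) (k : ℕ) →
    Connected G → Reduced G → IsBipartition G side →
    sizeA side ≤ sizeB side → sizeA side ≡ 2 * k → 3 ≤ k →
    HeightAtLeast G side 3 →
    RLeq G k
theorem4 {n} G side (suc (suc (suc k))) _ _ bip _ |A|≡2k (s≤s (s≤s (s≤s _))) height
  with a , b , c , Na⊆Nb , Nb⊆Nc , (a≢b , a≢c , b≢c) , Aa , Ab , Ac ← sorted-triple {G = G} {side} height
  with r₁ , σ₁ ← ∈⇒↭∷ (∈-filter⁺ (λ v → side v ≟ᵇ true) (∈-allFin a) Aa)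
  with r₂ , σ₂ ← ∈⇒↭∷ (∈-tail (≢-sym a≢b) (∈-resp-↭ σ₁ (∈-filter⁺ (λ v → side v ≟ᵇ true) (∈-allFin b) Ab)))
  with r₃ , σ₃ ← ∈⇒↭∷ (∈-tail (≢-sym b≢c) (∈-resp-↭ σ₂ (∈-tail (≢-sym a≢c)
                    (∈-resp-↭ σ₁ (∈-filter⁺ (λ v → side v ≟ᵇ true) (∈-allFin c) Ac)))))
  = finish r₃ σ (trans (sym (↭-length σ)) (trans |A|≡2k (*-distribˡ-+ 2 3 k)))
  where
  σ = ↭-trans σ₁ (prep a (↭-trans σ₂ (prep b σ₃)))
  open PermSetoid (setoid (Fin n)) using (Unique-resp-↭)
  finish : ∀ r → filter (λ v → side v ≟ᵇ true) (allFin n) ↭ a ∷ b ∷ c ∷ r → 3 + length r ≡ 6 + 2 * k →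
           RLeq G (3 + k)
  -- Here `k` is the bound minus 3, and `3 + 2 * k` letters remain besides the chain: `x`, the pair
  -- `u`, `v`, and `k` further pairs. The assumption that the bound is at least 3 guarantees the
  -- first pair, hence the gadget that precedes the ending.
  finish (x ∷ u ∷ v ∷ ys) σ e
    with qs , refl , refl ← pair-up k ys (+-cancelˡ-≡ 6 _ _ e)
    = 3 + length qs , ≤-refl , word (blocks u v qs d A⊆) , uniform u v qs d A⊆ , represents u v qs d A⊆
    where
    open Words side using (word)
    open Representation G side bip x a b c Na⊆Nb Nb⊆Nc
    τ : filter (λ v → side v ≟ᵇ true) (allFin n) ↭ flatten ((u , v) ∷ qs) ++ x ∷ a ∷ b ∷ c ∷ []
    τ = ↭-trans σ (↭-trans (shift x (a ∷ b ∷ c ∷ []) _) (++-comm (x ∷ a ∷ b ∷ c ∷ []) (u ∷ v ∷ flatten qs)))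
    d : Distinct (u , v) qs
    d = Unique-resp-↭ (↭⇒↭ₛ τ) (filter⁺ _ (allFin⁺ n))
    A⊆ : ∀ {y} → side y ≡ true → y ∈ flatten ((u , v) ∷ qs) ++ x ∷ a ∷ b ∷ c ∷ []
    A⊆ {y} Ay = ∈-resp-↭ τ (∈-filter⁺ _ (∈-allFin y) Ay)
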